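{- For all $n\ge 2$, $full_n^{P_2^{(2,2)}}=C_{n-1}$, where $C_n=\frac{1}{n+1}\binom{2n}{n}$ is the $n$-th Catalan number.
   Context: $\mathcal{F}_{n,2}$ is the set of all fillings $F$ of the $2\times n$ rectangular array (2 rows, $n$ columns) with the integers $1,\dots,2n$, each used once, such that in each column the bottom entry is smaller than the top entry. $P_2^{(2,2)}\in\mathcal{F}_{2,2}$ is the filling with bottom row $1,2$ and top row $3,4$ (reading left to right). For a $2\times 2$ filling by distinct positive integers, $\mathrm{red}$ replaces the $i$-th smallest entry by $i$. $F\in\mathcal{F}_{n,2}$ has a $P$-match starting at position $i$ ($1\le i\le n-1$) if the reduction of the $2\times2$ filling formed by columns $i,i+1$ of $F$ equals $P$. $full_n^{P}$ is the number of $F\in\mathcal{F}_{n,2}$ having $P$-matches starting at every position $1,\dots,n-1$. -}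

module Defs where

open import Data.Fin using (Fin; toℕ)
open import Data.Fin.Properties using (all?)
open import Data.List using (List; []; _∷_; [_]; _++_; map; length; filter; upTo;
  cartesianProduct; cartesianProductWith)
open import Data.List.Membership.DecPropositional using () renaming (_∈?_ to member?)
open import Data.List.Membership.Propositional using (_∈_)
open import Data.List.Membership.Propositional.Properties
  using (∈-∃++; ∈-filter⁺; ∈-filter⁻; ∈-cartesianProduct⁺; ∈-cartesianProductWith⁺; ∈-++⁺ˡ; ∈-++⁺ʳ)
open import Data.List.Relation.Binary.Permutation.Propositional
  using (_↭_; ↭-refl; ↭-sym; ↭-trans; prep)
open import Data.List.Relation.Binary.Permutation.Propositional.Properties
  using (shift; drop-mid; ∈-resp-↭; ¬x∷xs↭[])
open import Data.List.Relation.Unary.All using ([])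
open import Data.List.Relation.Unary.AllPairs using ([]; _∷_)
open import Data.List.Relation.Unary.Any using (here; there)
open import Data.List.Relation.Unary.Unique.Propositional using (Unique)
import Data.List.Relation.Unary.Unique.Propositional.Properties as Unique
open import Data.Nat using (ℕ; zero; suc; _+_; _*_; _≤?_; _<_; _<?_; _/_; _≟_)
open import Data.Nat.Combinatorics using (_C_; nC1≡n; nCk+nC[k+1]≡[n+1]C[k+1])
open import Data.Nat.DivMod using (m*[n/m]≡n)
open import Data.Nat.Divisibility using (_∣_; divides; ∣m+n∣m⇒∣n; m∣m*n)
open import Data.Nat.Properties using (*-zeroʳ; *-identityˡ; *-identityʳ; *-distribˡ-+)
open import Data.Nat.Tactic.RingSolver using (solve-∀)
open import Data.Product using (_×_; _,_; proj₁; proj₂)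
open import Data.Product.Properties using () renaming (≡-dec to ×-≡-dec)
open import Data.Vec using (Vec; []; _∷_; lookup; toList) renaming (map to mapᵥ)
open import Data.Vec.Properties using (∷-injective) renaming (≡-dec to Vec-≡-dec)
open import Function using (_⇔_; mk⇔; _∘_)
open import Relation.Binary using (Decidable)
open import Relation.Binary.PropositionalEquality
  using (_≡_; refl; sym; trans; cong; cong₂; module ≡-Reasoning)
open import Relation.Nullary using (yes; no)
open import Relation.Nullary.Decidable using (_×-dec_; _→-dec_)
import Relation.Unary as U

-- Used only to make IsFilling decidable, so that fillings can be counted.

infix 4 _↭?_

_↭?_ : Decidable (_↭_ {A = ℕ})
[]       ↭? []       = yes ↭-refl
[]       ↭? (y ∷ ys) = no (¬x∷xs↭[] ∘ ↭-sym)
(x ∷ xs) ↭? ys with member? _≟_ x ys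
... | no  x∉ys = no λ p → x∉ys (∈-resp-↭ p (here refl))
... | yes x∈ys with ∈-∃++ x∈ys
...   | as , bs , refl with xs ↭? (as ++ bs)
...     | yes p = yes (↭-trans (prep x p) (↭-sym (shift x as bs)))
...     | no ¬p = no (¬p ∘ drop-mid [] as)

-- An array with two rows and n columns, given as (bottom row , top row).

Array : ℕ → Set
Array n = Vec ℕ n × Vec ℕ n

bottom top : ∀ {n} → Array n → Vec ℕ n
bottom = proj₁
top    = proj₂

entries : ∀ {n} → Array n → List ℕ
entries F = toList (bottom F) ++ toList (top F)

[1⋯_] : ℕ → List ℕ
[1⋯ m ] = map suc (upTo m)

IsFilling : ∀ {n} → Array n → Set
IsFilling {n} F =
  (∀ (i : Fin n) → lookup (bottom F) i < lookup (top F) i) ×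
  entries F ↭ [1⋯ 2 * n ]

isFilling? : ∀ {n} → U.Decidable (IsFilling {n})
isFilling? F =
  all? (λ i → lookup (bottom F) i <? lookup (top F) i) ×-dec
  entries F ↭? [1⋯ _ ]

-- When the entries are distinct, the i-th smallest entry is the one with
-- exactly i entries less than or equal to it.

red : ∀ {n} → Array n → Array n
red F = mapᵥ rank (bottom F) , mapᵥ rank (top F)
  where
  rank : ℕ → ℕ
  rank x = length (filter (_≤? x) (entries F))

columns : ∀ {n} → Array n → Fin n → Fin n → Array 2
columns F i j =
  (lookup (bottom F) i ∷ lookup (bottom F) j ∷ []) ,
  (lookup (top    F) i ∷ lookup (top    F) j ∷ [])

-- A P-match at every position; the positions are the pairs of consecutive
-- column indices (i , j = i + 1).

FullyMatches : Array 2 → ∀ {n} → Array n → Set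
FullyMatches P {n} F =
  ∀ (i j : Fin n) → toℕ j ≡ suc (toℕ i) → red (columns F i j) ≡ P

fullyMatches? : ∀ P {n} → U.Decidable (FullyMatches P {n})
fullyMatches? P F = all? λ i → all? λ j →
  (toℕ j ≟ suc (toℕ i)) →-dec
  ×-≡-dec (Vec-≡-dec _≟_) (Vec-≡-dec _≟_) (red (columns F i j)) P

vecs : List ℕ → ∀ n → List (Vec ℕ n)
vecs xs zero    = [ [] ]
vecs xs (suc n) = cartesianProductWith _∷_ xs (vecs xs n)

arrays : ∀ n → List (Array n)
arrays n = cartesianProduct (vecs [1⋯ 2 * n ] n) (vecs [1⋯ 2 * n ] n)

fillings : ∀ n → List (Array n)
fillings n = filter isFilling? (arrays n)

full : Array 2 → ℕ → ℕ
full P n = length (filter (fullyMatches? P) (fillings n))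

P₂⁽²'²⁾ : Array 2
P₂⁽²'²⁾ = (1 ∷ 2 ∷ []) , (3 ∷ 4 ∷ [])

-- The division is exact: see suc[n]*catalan below.

catalan : ℕ → ℕ
catalan n = ((2 * n) C n) / suc n

-- The list of fillings is complete and without repetitions, so that its
-- length (and that of its sublists) is a cardinality.

∈-vecs : ∀ {xs n} (v : Vec ℕ n) → (∀ {x} → x ∈ toList v → x ∈ xs) → v ∈ vecs xs n
∈-vecs []      _ = here refl
∈-vecs (x ∷ v) h = ∈-cartesianProductWith⁺ _∷_ (h (here refl)) (∈-vecs v (h ∘ there))

vecs-unique : ∀ {xs} → Unique xs → ∀ n → Unique (vecs xs n)
vecs-unique u zero    = [] ∷ []
vecs-unique u (suc n) = Unique.cartesianProductWith⁺ _∷_ ∷-injective u (vecs-unique u n)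

∈-fillings : ∀ {n} (F : Array n) → F ∈ fillings n ⇔ IsFilling F
∈-fillings {n} F = mk⇔ (proj₂ ∘ ∈-filter⁻ isFilling? {xs = arrays n}) λ p →
  ∈-filter⁺ isFilling?
    (∈-cartesianProduct⁺
      (∈-vecs (bottom F) (∈-resp-↭ (proj₂ p) ∘ ∈-++⁺ˡ))
      (∈-vecs (top F) (∈-resp-↭ (proj₂ p) ∘ ∈-++⁺ʳ (toList (bottom F)))))
    p

fillings-unique : ∀ n → Unique (fillings n)
fillings-unique n = Unique.filter⁺ isFilling? (Unique.cartesianProduct⁺ u u)
  where
  u : Unique (vecs [1⋯ 2 * n ] n)
  u = vecs-unique (Unique.map⁺ (λ { refl → refl }) (Unique.upTo⁺ (2 * n))) n

absorption : ∀ n k → suc k * (suc n C suc k) ≡ suc n * (n C k)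
absorption zero    zero    = refl
absorption zero    (suc k) = *-zeroʳ (suc (suc k))
absorption (suc n) zero    =
  trans (*-identityˡ _) (trans (nC1≡n (suc (suc n))) (sym (*-identityʳ _)))
absorption (suc n) (suc k) = begin
  suc (suc k) * (suc (suc n) C suc (suc k))
    ≡⟨ cong (suc (suc k) *_) (nCk+nC[k+1]≡[n+1]C[k+1] (suc n) (suc k)) ⟨
  suc (suc k) * (a + b)
    ≡⟨ expand k a b ⟩
  a + (suc k * a + suc (suc k) * b)
    ≡⟨ cong (a +_) (cong₂ _+_ (absorption n k) (absorption n (suc k))) ⟩
  a + (suc n * (n C k) + suc n * (n C suc k))
    ≡⟨ cong (a +_) (*-distribˡ-+ (suc n) (n C k) (n C suc k)) ⟨
  a + suc n * (n C k + n C suc k)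
    ≡⟨ cong (λ c → a + suc n * c) (nCk+nC[k+1]≡[n+1]C[k+1] n k) ⟩
  suc (suc n) * a ∎
  where
  open ≡-Reasoning
  a b : ℕ
  a = suc n C suc k
  b = suc n C suc (suc k)
  expand : ∀ k a b → suc (suc k) * (a + b) ≡ a + (suc k * a + suc (suc k) * b)
  expand = solve-∀

suc[n]∣2nCn : ∀ n → suc n ∣ (2 * n) C n
suc[n]∣2nCn n = ∣m+n∣m⇒∣n (divides (2 * x) eq) (m∣m*n (suc (2 * n) C suc n))
  where
  x : ℕ
  x = (2 * n) C n
  collect : ∀ n x → suc (2 * n) * x + x ≡ 2 * x * suc n
  collect = solve-∀
  eq : suc n * (suc (2 * n) C suc n) + x ≡ 2 * x * suc n
  eq = trans (cong (_+ x) (absorption (2 * n) n)) (collect n x)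

suc[n]*catalan : ∀ n → suc n * catalan n ≡ (2 * n) C n
suc[n]*catalan n = m*[n/m]≡n (suc[n]∣2nCn n)

{-# OPTIONS --safe --termination-depth=2 #-}
module Submission where

-- A filling matches the pattern at every position exactly when both of its
-- rows increase and every bottom entry is smaller than the top entry of the
-- preceding column.  Read the values 1, …, 2n in order and record whether each
-- one lies in the bottom or in the top row.  The condition then says that, at
-- every value before 2n, strictly more bottom than top entries have been read:
-- the record is a Dyck path of length 2n that returns to its starting height
-- only at the end, and there are C (n - 1) of these.
--
-- The count removes the smallest value first.  What is left at each stage is a
-- pair of rows of lengths p and q, filled with consecutive values from some k
-- on, aligned at its right end ("Interleaved").  The next value k must head one
-- of the two rows, and it may head the top row only if the bottom row remains
-- strictly shorter than the top row (or is empty).  This recursion is the list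
-- "interleavings", which lists each interleaved pair once ("sound",
-- "complete", "interleavings-unique").  Its length satisfies the recurrence of
-- the ballot numbers, whose solution by Pascal's rule is
--   (p + q - 1) C p  -  (p + q - 1) C (p - 1)         ("ballot").
-- The value 1 must open the bottom row, after which p = n - 1 and q = n; for
-- these values the difference is the Catalan number C (n - 1).

open import Defs
open import Data.Fin using (Fin; zero; suc; toℕ; inject₁)
open import Data.Fin.Properties using (toℕ-inject₁)
open import Data.List using (List; []; _∷_; _++_; map; length; filter; applyUpTo)
open import Data.List.Membership.Propositional using (_∈_)
open import Data.List.Membership.Propositional.Properties
  using (∈-map⁺; ∈-map⁻; ∈-++⁺ˡ; ∈-++⁺ʳ; ∈-++⁻; ∈-filter⁺; ∈-filter⁻)
open import Data.List.Properties
  using (length-map; length-++; map-upTo; filter-accept; filter-reject)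
open import Data.List.Relation.Binary.Disjoint.Propositional using (Disjoint)
open import Data.List.Relation.Binary.Permutation.Propositional
  using (_↭_; ↭-refl; ↭-sym; ↭-trans; ↭-reflexive; prep)
open import Data.List.Relation.Binary.Permutation.Propositional.Properties
  using (shift; drop-∷; drop-mid; ∈-resp-↭; All-resp-↭; ↭-length)
open import Data.List.Relation.Binary.BagAndSetEquality using (∼bag⇒↭)
open import Data.List.Membership.Propositional.Properties.WithK using (unique∧set⇒bag)
open import Data.List.Relation.Unary.All as All using (All; []; _∷_)
open import Data.List.Relation.Unary.All.Properties using (++⁻ˡ; ++⁻ʳ)
open import Data.List.Relation.Unary.AllPairs using ([]; _∷_)
open import Data.List.Relation.Unary.Any using (here; there)
open import Data.List.Relation.Unary.Unique.Propositional using (Unique)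
open import Data.List.Relation.Unary.Unique.Propositional.Properties
  using (map⁺; ++⁺; filter⁺)
open import Data.Nat using (ℕ; zero; suc; _+_; _*_; _∸_; _≤_; _<_; z≤n; s≤s;
  _≤?_; _<?_)
open import Data.Nat.Combinatorics using (_C_; nCk≡nC[n∸k]; nCk+nC[k+1]≡[n+1]C[k+1])
open import Data.Nat.Properties
open import Data.Nat.Tactic.RingSolver using (solve-∀)
open import Data.Product using (_×_; _,_; proj₁; proj₂)
open import Data.Product.Properties using (,-injectiveˡ; ,-injectiveʳ)
open import Data.Sum using (_⊎_; inj₁; inj₂)
open import Data.Vec using (Vec; []; _∷_; lookup; toList)
import Data.Vec.Properties as Vec
import Data.Vec.Relation.Unary.All as VecAll
import Data.Vec.Relation.Unary.All.Properties as VecAll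
open import Function using (_⇔_; mk⇔; Equivalence)
open import Relation.Binary.PropositionalEquality
open import Relation.Nullary using (yes; no; contradiction)

-- Matches of the pattern

-- The number of elements of L that are at most x: the rank of x used by red,
-- if L lists the entries.  It is monotone in x, so strictly larger ranks belong
-- to strictly larger entries.

countBelow : List ℕ → ℕ → ℕ
countBelow L x = length (filter (_≤? x) L)

countBelow-accept : ∀ {a x} L → a ≤ x → countBelow (a ∷ L) x ≡ suc (countBelow L x)
countBelow-accept {x = x} L a≤x = cong length (filter-accept (_≤? x) a≤x)

countBelow-reject : ∀ {a x} L → x < a → countBelow (a ∷ L) x ≡ countBelow L x
countBelow-reject {x = x} L x<a = cong length (filter-reject (_≤? x) (<⇒≱ x<a))

countBelow-mono : ∀ L {x y} → x ≤ y → countBelow L x ≤ countBelow L y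
countBelow-mono []      x≤y = z≤n
countBelow-mono (a ∷ L) {x} {y} x≤y with a ≤? x | a ≤? y
... | yes a≤x | _ = begin
  countBelow (a ∷ L) x ≡⟨ countBelow-accept L a≤x ⟩
  suc (countBelow L x) ≤⟨ s≤s (countBelow-mono L x≤y) ⟩
  suc (countBelow L y) ≡⟨ countBelow-accept L (≤-trans a≤x x≤y) ⟨
  countBelow (a ∷ L) y ∎
  where open ≤-Reasoning
... | no a≰x | yes a≤y = begin
  countBelow (a ∷ L) x ≡⟨ countBelow-reject L (≰⇒> a≰x) ⟩
  countBelow L x       ≤⟨ m≤n⇒m≤1+n (countBelow-mono L x≤y) ⟩
  suc (countBelow L y) ≡⟨ countBelow-accept L a≤y ⟨
  countBelow (a ∷ L) y ∎
  where open ≤-Reasoning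
... | no a≰x | no a≰y = begin
  countBelow (a ∷ L) x ≡⟨ countBelow-reject L (≰⇒> a≰x) ⟩
  countBelow L x       ≤⟨ countBelow-mono L x≤y ⟩
  countBelow L y       ≡⟨ countBelow-reject L (≰⇒> a≰y) ⟨
  countBelow (a ∷ L) y ∎
  where open ≤-Reasoning

countBelow-cancel-< : ∀ L {x y} → countBelow L x < countBelow L y → x < y
countBelow-cancel-< L lt = ≰⇒> λ y≤x → <⇒≱ lt (countBelow-mono L y≤x)

countBelow-none : ∀ {x L} → All (x <_) L → countBelow L x ≡ 0
countBelow-none []               = refl
countBelow-none (x<a ∷ x<L) = trans (countBelow-reject _ x<a) (countBelow-none x<L)

countBelow-split : ∀ x {L M} → All (_≤ x) L → All (x <_) M →
  countBelow (L ++ M) x ≡ length L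
countBelow-split x         []          x<M = countBelow-none x<M
countBelow-split x {L = _ ∷ L} (a≤x ∷ L≤x) x<M =
  trans (countBelow-accept (L ++ _) a≤x) (cong suc (countBelow-split x L≤x x<M))

red-P⁺ : ∀ {a b c d} → a < b → b < c → c < d →
  red ((a ∷ b ∷ []) , (c ∷ d ∷ [])) ≡ P₂⁽²'²⁾
red-P⁺ {a} {b} {c} {d} a<b b<c c<d = cong₂ _,_
  (cong₂ (λ x y → x ∷ y ∷ [])
    (countBelow-split a (≤-refl ∷ []) (a<b ∷ a<c ∷ a<d ∷ []))
    (countBelow-split b (<⇒≤ a<b ∷ ≤-refl ∷ []) (b<c ∷ b<d ∷ [])))
  (cong₂ (λ x y → x ∷ y ∷ [])
    (countBelow-split c (<⇒≤ a<c ∷ <⇒≤ b<c ∷ ≤-refl ∷ []) (c<d ∷ []))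
    (countBelow-split d (<⇒≤ a<d ∷ <⇒≤ b<d ∷ <⇒≤ c<d ∷ ≤-refl ∷ []) []))
  where
  a<c : a < c
  a<c = <-trans a<b b<c
  b<d : b < d
  b<d = <-trans b<c c<d
  a<d : a < d
  a<d = <-trans a<c c<d

red-P⁻ : ∀ {a b c d} → red ((a ∷ b ∷ []) , (c ∷ d ∷ [])) ≡ P₂⁽²'²⁾ →
  a < b × b < c × c < d
red-P⁻ {a} {b} {c} {d} eq = less ea eb ≤-refl , less eb ec ≤-refl , less ec ed ≤-refl
  where
  L : List ℕ
  L = a ∷ b ∷ c ∷ d ∷ []
  less : ∀ {x y r s} → countBelow L x ≡ r → countBelow L y ≡ s → r < s → x < y
  less refl refl = countBelow-cancel-< L
  ea : countBelow L a ≡ 1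
  ea = Vec.∷-injectiveˡ (,-injectiveˡ eq)
  eb : countBelow L b ≡ 2
  eb = Vec.∷-injectiveˡ (Vec.∷-injectiveʳ (,-injectiveˡ eq))
  ec : countBelow L c ≡ 3
  ec = Vec.∷-injectiveˡ (,-injectiveʳ eq)
  ed : countBelow L d ≡ 4
  ed = Vec.∷-injectiveˡ (Vec.∷-injectiveʳ (,-injectiveʳ eq))

-- Interleaved pairs of rows

-- The list k, k + 1, …, k + m - 1.

range : ℕ → ℕ → List ℕ
range k zero    = []
range k (suc m) = k ∷ range (suc k) m

range-≥ : ∀ k m → All (k ≤_) (range k m)
range-≥ k zero    = []
range-≥ k (suc m) = ≤-refl ∷ All.map <⇒≤ (range-≥ (suc k) m)

applyUpTo-range : ∀ {f k} m → (∀ i → f i ≡ k + i) → applyUpTo f m ≡ range k m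
applyUpTo-range zero    f≗ = refl
applyUpTo-range {k = k} (suc m) f≗ =
  cong₂ _∷_ (trans (f≗ 0) (+-identityʳ k))
    (applyUpTo-range m λ i → trans (f≗ (suc i)) (+-suc k i))

[1⋯]-range : ∀ m → [1⋯ m ] ≡ range 1 m
[1⋯]-range m = trans (map-upTo suc m) (applyUpTo-range m λ _ → refl)

Increasing : ∀ {n} → Vec ℕ n → Set
Increasing {n} v = ∀ (i j : Fin n) → toℕ j ≡ suc (toℕ i) → lookup v i < lookup v j

increasing-tail : ∀ {n x} {v : Vec ℕ n} → Increasing (x ∷ v) → Increasing v
increasing-tail inc i j e = inc (suc i) (suc j) (cong suc e)

increasing-cons : ∀ {n x} {v : Vec ℕ n} →
  VecAll.All (x <_) v → Increasing v → Increasing (x ∷ v)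
increasing-cons x<v inc zero    (suc j) e = VecAll.lookup⁺ x<v j
increasing-cons x<v inc (suc i) (suc j) e = inc i j (suc-injective e)

increasing-head : ∀ {n x} {v : Vec ℕ n} → Increasing (x ∷ v) → All (x <_) (toList v)
increasing-head {v = []}    inc = []
increasing-head {v = y ∷ v} inc =
  x<y ∷ All.map (<-trans x<y) (increasing-head (increasing-tail inc))
  where
  x<y = inc zero (suc zero) refl

increasing-minimum : ∀ {n x k} {v : Vec ℕ n} → Increasing (x ∷ v) → k ≤ x →
  k ∈ toList (x ∷ v) → x ≡ k
increasing-minimum inc k≤x (here refl) = refl
increasing-minimum inc k≤x (there k∈v) =
  contradiction k≤x (<⇒≱ (All.lookup (increasing-head inc) k∈v))

-- Part of an array: a bottom row of length p and a top row of length q.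

Rows : ℕ → ℕ → Set
Rows p q = Vec ℕ p × Vec ℕ q

-- The rows are thought of as right-aligned: the last p and the last q entries
-- of the two rows of an array.  In "crossing", entry i of the bottom row and
-- entry j of the top row are those for which j lies one column to the left
-- of i, that is, p - i = (q - j) - 1.

record Interleaved {p q} (k : ℕ) (R : Rows p q) : Set where
  constructor mkInterleaved
  field
    values     : toList (proj₁ R) ++ toList (proj₂ R) ↭ range k (p + q)
    bottom-inc : Increasing (proj₁ R)
    top-inc    : Increasing (proj₂ R)
    crossing   : ∀ (i : Fin p) (j : Fin q) → suc (toℕ j + p) ≡ toℕ i + q →
                 lookup (proj₁ R) i < lookup (proj₂ R) j

  values-≥ : All (k ≤_) (toList (proj₁ R) ++ toList (proj₂ R))
  values-≥ = All-resp-↭ (↭-sym values) (range-≥ k (p + q))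

  bottom-≥ : VecAll.All (k ≤_) (proj₁ R)
  bottom-≥ = VecAll.toList⁻ (++⁻ˡ _ values-≥)

  top-≥ : VecAll.All (k ≤_) (proj₂ R)
  top-≥ = VecAll.toList⁻ (++⁻ʳ (toList (proj₁ R)) values-≥)

open Interleaved

consBottom : ∀ {p q} → ℕ → Rows p q → Rows (suc p) q
consBottom k (b , t) = k ∷ b , t

consTop : ∀ {p q} → ℕ → Rows p q → Rows p (suc q)
consTop k (b , t) = b , k ∷ t

consBottom⁺ : ∀ {k p q} {R : Rows p q} →
  Interleaved (suc k) R → Interleaved k (consBottom k R)
consBottom⁺ {k} {p} {q} {b , t} r = mkInterleaved
  (prep k (values r))
  (increasing-cons (bottom-≥ r) (bottom-inc r))
  (top-inc r)
  cross
  where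
  cross : ∀ i j → suc (toℕ j + suc p) ≡ toℕ i + q → lookup (k ∷ b) i < lookup t j
  cross zero    j e = VecAll.lookup⁺ (top-≥ r) j
  cross (suc i) j e = crossing r i j
    (suc-injective (trans (cong suc (sym (+-suc (toℕ j) p))) e))

consBottom⁻ : ∀ {k p q} {R : Rows p q} →
  Interleaved k (consBottom k R) → Interleaved (suc k) R
consBottom⁻ {p = p} r = mkInterleaved
  (drop-∷ (values r))
  (increasing-tail (bottom-inc r))
  (top-inc r)
  λ i j e → crossing r (suc i) j (cong suc (trans (+-suc (toℕ j) p) e))

-- The value k is smaller than all bottom entries, so it can be put in front of
-- the top row only if no crossing condition compares it with one of them.

consTop⁺ : ∀ {k p q} {R : Rows p q} → p ≡ 0 ⊎ p < q →
  Interleaved (suc k) R → Interleaved k (consTop k R)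
consTop⁺ {k} {p} {q} {b , t} short r = mkInterleaved
  (↭-trans (shift k (toList b) (toList t))
    (↭-trans (prep k (values r)) (↭-reflexive (cong (range k) (sym (+-suc p q))))))
  (bottom-inc r)
  (increasing-cons (top-≥ r) (top-inc r))
  cross
  where
  short⇒< : Fin p → p ≡ 0 ⊎ p < q → p < q
  short⇒< () (inj₁ refl)
  short⇒< _  (inj₂ p<q) = p<q
  cross : ∀ i j → suc (toℕ j + p) ≡ toℕ i + suc q → lookup b i < lookup (k ∷ t) j
  cross i zero    e = contradiction
    (≤-trans (m≤n+m q (toℕ i))
      (≤-reflexive (suc-injective (trans (sym (+-suc (toℕ i) q)) (sym e)))))
    (<⇒≱ (short⇒< i short))
  cross i (suc j) e = crossing r i j
    (suc-injective (trans e (+-suc (toℕ i) q)))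

consTop⁻ : ∀ {k p q} {R : Rows p q} →
  Interleaved k (consTop k R) → Interleaved (suc k) R
consTop⁻ {k} {p} {q} {b , t} r = mkInterleaved
  (drop-mid (toList b) []
    (↭-trans (values r) (↭-reflexive (cong (range k) (+-suc p q)))))
  (bottom-inc r)
  (increasing-tail (top-inc r))
  λ i j e → crossing r i (suc j) (trans (cong suc e) (sym (+-suc (toℕ i) q)))

head-minimum : ∀ {k p q x y} {b : Vec ℕ p} {t : Vec ℕ q} →
  Interleaved k (x ∷ b , y ∷ t) → x ≡ k ⊎ y ≡ k
head-minimum {b = b} r
  with ∈-++⁻ (_ ∷ toList b) (∈-resp-↭ (↭-sym (values r)) (here refl))
... | inj₁ k∈b = inj₁ (increasing-minimum (bottom-inc r) (VecAll.head (bottom-≥ r)) k∈b)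
... | inj₂ k∈t = inj₂ (increasing-minimum (top-inc r) (VecAll.head (top-≥ r)) k∈t)

-- Enumeration of the interleaved pairs

-- All interleaved pairs with values from k on, if p = 0 or p < q; the list is
-- empty otherwise.  Started with p = 0 or p < q, the recursion meets an empty
-- list only after a value is put where it cannot stand, at the head of a top
-- row that is just one longer than the bottom row.

interleavings : ℕ → ∀ p q → List (Rows p q)
interleavings k zero    zero    = ([] , []) ∷ []
interleavings k zero    (suc q) = map (consTop k) (interleavings (suc k) zero q)
interleavings k (suc p) zero    = []
interleavings k (suc p) (suc q) with p <? q
... | no  _ = []
... | yes _ = map (consBottom k) (interleavings (suc k) p (suc q)) ++
              map (consTop k) (interleavings (suc k) (suc p) q)

interleavings-short : ∀ {k p q R} → R ∈ interleavings k (suc p) q → suc p < q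
interleavings-short {p = p} {suc q} R∈ with p <? q
interleavings-short {p = p} {suc q} () | no _
... | yes p<q = s≤s p<q

sound : ∀ {k} p q {R} → R ∈ interleavings k p q → Interleaved k R
sound zero zero (here refl) = mkInterleaved ↭-refl (λ ()) (λ ()) (λ ())
sound zero (suc q) R∈ with ∈-map⁻ _ R∈
... | _ , R∈′ , refl = consTop⁺ (inj₁ refl) (sound zero q R∈′)
sound {k} (suc p) (suc q) R∈ with p <? q
sound (suc p) (suc q) () | no _
... | yes _ with ∈-++⁻ (map (consBottom k) (interleavings (suc k) p (suc q))) R∈
...   | inj₁ R∈₁ with ∈-map⁻ _ R∈₁
...     | _ , R∈′ , refl = consBottom⁺ (sound p (suc q) R∈′)
sound (suc p) (suc q) R∈ | yes _ | inj₂ R∈₂ with ∈-map⁻ _ R∈₂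
... | _ , R∈′ , refl = consTop⁺ (inj₂ (interleavings-short R∈′)) (sound (suc p) q R∈′)

consBottom-∈ : ∀ {k p q} {R : Rows p (suc q)} → p < q →
  R ∈ interleavings (suc k) p (suc q) → consBottom k R ∈ interleavings k (suc p) (suc q)
consBottom-∈ {k} {p} {q} p<q R∈ with p <? q
... | yes _   = ∈-++⁺ˡ (∈-map⁺ (consBottom k) R∈)
... | no  p≮q = contradiction p<q p≮q

consTop-∈ : ∀ {k p q} {R : Rows (suc p) q} → p < q →
  R ∈ interleavings (suc k) (suc p) q → consTop k R ∈ interleavings k (suc p) (suc q)
consTop-∈ {k} {p} {q} p<q R∈ with p <? q
... | yes _   = ∈-++⁺ʳ _ (∈-map⁺ (consTop k) R∈)
... | no  p≮q = contradiction p<q p≮q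

-- The lengths decrease lexicographically; the termination depth of 2 is for the
-- call on (suc p , q), which lies below a match on head-minimum.

complete : ∀ {k} p q {R : Rows p q} → p ≡ 0 ⊎ p < q → Interleaved k R →
  R ∈ interleavings k p q
complete zero zero {[] , []} _ r = here refl
complete {k} zero (suc q) {[] , y ∷ t} _ r
  with increasing-minimum (top-inc r) (VecAll.head (top-≥ r))
         (∈-resp-↭ (↭-sym (values r)) (here refl))
... | refl = ∈-map⁺ (consTop k) (complete zero q (inj₁ refl) (consTop⁻ r))
complete {k} (suc p) (suc q) {x ∷ b , y ∷ t} (inj₂ (s≤s p<q)) r with head-minimum r
... | inj₁ refl = consBottom-∈ p<q (complete p (suc q) (inj₂ (m<n⇒m<1+n p<q)) (consBottom⁻ r))
... | inj₂ refl = consTop-∈ p<q (complete (suc p) q (inj₂ (≤∧≢⇒< p<q 1+p≢q)) (consTop⁻ r))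
  where
  -- If the rows had lengths p + 1 and p + 2, the crossing condition would
  -- compare their heads, and k could not head the top row.
  1+p≢q : suc p ≢ q
  1+p≢q refl = <⇒≱ (crossing r zero zero refl) (VecAll.head (bottom-≥ r))

consBottom-injective : ∀ {k p q} {R S : Rows p q} → consBottom k R ≡ consBottom k S → R ≡ S
consBottom-injective refl = refl

consTop-injective : ∀ {k p q} {R S : Rows p q} → consTop k R ≡ consTop k S → R ≡ S
consTop-injective refl = refl

interleavings-unique : ∀ k p q → Unique (interleavings k p q)
interleavings-unique k zero    zero    = [] ∷ []
interleavings-unique k zero    (suc q) =
  map⁺ consTop-injective (interleavings-unique (suc k) zero q)
interleavings-unique k (suc p) zero    = []
interleavings-unique k (suc p) (suc q) with p <? q
... | no  _ = []
... | yes _ = ++⁺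
  (map⁺ consBottom-injective (interleavings-unique (suc k) p (suc q)))
  (map⁺ consTop-injective (interleavings-unique (suc k) (suc p) q))
  disjoint
  where
  -- In the second list, all bottom entries exceed k.
  disjoint : Disjoint (map (consBottom k) (interleavings (suc k) p (suc q)))
                      (map (consTop k) (interleavings (suc k) (suc p) q))
  disjoint (∈₁ , ∈₂) with ∈-map⁻ _ ∈₁ | ∈-map⁻ _ ∈₂
  ... | _ , _ , refl | _ , R∈ , refl =
    <-irrefl refl (VecAll.head (bottom-≥ (sound (suc p) q R∈)))

-- Fully matching fillings

consecutive : ∀ {n} {F : Array n} → FullyMatches P₂⁽²'²⁾ F → ∀ i j → toℕ j ≡ suc (toℕ i) →
  lookup (bottom F) i < lookup (bottom F) j ×
  lookup (bottom F) j < lookup (top F) i ×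
  lookup (top F) i < lookup (top F) j
consecutive match i j e = red-P⁻ (match i j e)

values-filling : ∀ n → [1⋯ 2 * n ] ≡ range 1 (n + n)
values-filling n = trans ([1⋯]-range (2 * n)) (cong (λ m → range 1 (n + m)) (+-identityʳ n))

interleaved⁺ : ∀ {n} {F : Array n} → IsFilling F → FullyMatches P₂⁽²'²⁾ F → Interleaved 1 F
interleaved⁺ {n} {F} (_ , perm) match = mkInterleaved
  (↭-trans perm (↭-reflexive (values-filling n)))
  (λ i j e → proj₁ (consecutive {F = F} match i j e))
  (λ i j e → proj₂ (proj₂ (consecutive {F = F} match i j e)))
  λ i j e → proj₁ (proj₂ (consecutive {F = F} match j i (+-cancelʳ-≡ n _ _ (sym e))))

interleaved⇒match : ∀ {n k} {F : Array n} → Interleaved k F → FullyMatches P₂⁽²'²⁾ F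
interleaved⇒match {n} r i j e = red-P⁺
  (bottom-inc r i j e)
  (crossing r j i (cong (_+ n) (sym e)))
  (top-inc r i j e)

-- In the first column the bottom entry is 1; in a later column it is smaller
-- than the top entry of the column before, hence than that of its own column.

interleaved⇒filling : ∀ {n} {R : Rows n (suc n)} → Interleaved 2 R →
  IsFilling (consBottom 1 R)
interleaved⇒filling {n} {b , t} r =
  column , ↭-trans (values r′) (↭-reflexive (sym (values-filling (suc n))))
  where
  r′ : Interleaved 1 (1 ∷ b , t)
  r′ = consBottom⁺ r
  column : ∀ i → lookup (1 ∷ b) i < lookup t i
  column zero    = VecAll.lookup⁺ (top-≥ r) zero
  column (suc i) = <-trans
    (crossing r′ (suc i) (inject₁ i) (cong (λ j → suc (j + suc n)) (toℕ-inject₁ i)))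
    (top-inc r′ (inject₁ i) (suc i) (cong suc (sym (toℕ-inject₁ i))))

fullFillings : ∀ n → List (Array n)
fullFillings n = filter (fullyMatches? P₂⁽²'²⁾) (fillings n)

fullFillings⇔ : ∀ n {F} →
  F ∈ fullFillings (suc n) ⇔ F ∈ map (consBottom 1) (interleavings 2 n (suc n))
fullFillings⇔ n = mk⇔ to from
  where
  to : ∀ {F} → F ∈ fullFillings (suc n) → F ∈ map (consBottom 1) (interleavings 2 n (suc n))
  to {x ∷ b , y ∷ t} F∈ with ∈-filter⁻ (fullyMatches? P₂⁽²'²⁾) {xs = fillings (suc n)} F∈
  ... | F∈′ , match with Equivalence.to (∈-fillings _) F∈′
  ...   | filling with interleaved⁺ filling match
  ...     | r with head-minimum r
  ...       | inj₁ refl = ∈-map⁺ (consBottom 1)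
    (complete n (suc n) (inj₂ ≤-refl) (consBottom⁻ r))
  ...       | inj₂ refl = contradiction (proj₁ filling zero) (≤⇒≯ (VecAll.head (bottom-≥ r)))
  from : ∀ {F} → F ∈ map (consBottom 1) (interleavings 2 n (suc n)) → F ∈ fullFillings (suc n)
  from F∈ with ∈-map⁻ _ F∈
  ... | _ , R∈ , refl with sound n (suc n) R∈
  ...   | r = ∈-filter⁺ (fullyMatches? P₂⁽²'²⁾)
    (Equivalence.from (∈-fillings _) (interleaved⇒filling r))
    (interleaved⇒match (consBottom⁺ r))

full-interleavings : ∀ n → full P₂⁽²'²⁾ (suc n) ≡ length (interleavings 2 n (suc n))
full-interleavings n = trans
  (↭-length (∼bag⇒↭ (unique∧set⇒bag
    (filter⁺ (fullyMatches? P₂⁽²'²⁾) (fillings-unique (suc n)))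
    (map⁺ consBottom-injective (interleavings-unique 2 n (suc n)))
    (fullFillings⇔ n))))
  (length-map (consBottom 1) (interleavings 2 n (suc n)))

-- Ballot numbers

count-zero : ∀ k q → length (interleavings k zero q) ≡ 1
count-zero k zero    = refl
count-zero k (suc q) = trans (length-map (consTop k) (interleavings (suc k) zero q))
  (count-zero (suc k) q)

middle-symmetric : ∀ p → (p + suc p) C p ≡ (p + suc p) C suc p
middle-symmetric p =
  trans (nCk≡nC[n∸k] (m≤m+n p (suc p))) (cong ((p + suc p) C_) (m+n∸m≡n p (suc p)))

-- The bottom row has length p + 1.  The case q = p + 1 is allowed: there
-- the list is empty and the two binomial coefficients agree, which is the base
-- of the induction.

ballot : ∀ k p q → suc p ≤ q →
  length (interleavings k (suc p) q) + (p + q) C p ≡ (p + q) C suc p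
ballot k p (suc q) (s≤s p≤q) with p <? q
... | no p≮q with refl ← ≤-antisym p≤q (≮⇒≥ p≮q) = middle-symmetric p
... | yes p<q = begin
  length (map (consBottom k) first ++ map (consTop k) second) + (p + suc q) C p
    ≡⟨ cong₂ _+_ lengths (cong (_C p) (+-suc p q)) ⟩
  length first + length second + suc (p + q) C p
    ≡⟨ step p p<q ⟩
  (p + q) C p + (p + q) C suc p
    ≡⟨ nCk+nC[k+1]≡[n+1]C[k+1] (p + q) p ⟩
  suc (p + q) C suc p
    ≡⟨ cong (_C suc p) (+-suc p q) ⟨
  (p + suc q) C suc p ∎
  where
  open ≡-Reasoning
  first : List (Rows p (suc q))
  first = interleavings (suc k) p (suc q)
  second : List (Rows (suc p) q)
  second = interleavings (suc k) (suc p) q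
  lengths : length (map (consBottom k) first ++ map (consTop k) second) ≡
            length first + length second
  lengths = trans (length-++ (map (consBottom k) first))
    (cong₂ _+_ (length-map (consBottom k) first) (length-map (consTop k) second))
  regroup : ∀ a b c d → (a + b) + (c + d) ≡ (a + c) + (b + d)
  regroup = solve-∀
  step : ∀ p → p < q →
    length (interleavings (suc k) p (suc q)) + length (interleavings (suc k) (suc p) q)
      + suc (p + q) C p ≡ (p + q) C p + (p + q) C suc p
  step zero p<q = begin
    length (interleavings (suc k) 0 (suc q)) + length (interleavings (suc k) 1 q) + 1
      ≡⟨ cong (λ a → a + length (interleavings (suc k) 1 q) + 1) (count-zero (suc k) (suc q)) ⟩
    1 + (length (interleavings (suc k) 1 q) + 1)
      ≡⟨ cong suc (ballot (suc k) zero q p<q) ⟩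
    1 + q C 1 ∎
  step (suc p) p<q = begin
    A + B + suc (suc p + q) C suc p
      ≡⟨ cong (A + B +_) (nCk+nC[k+1]≡[n+1]C[k+1] (suc p + q) p) ⟨
    A + B + ((suc p + q) C p + (suc p + q) C suc p)
      ≡⟨ regroup A B _ _ ⟩
    (A + (suc p + q) C p) + (B + (suc p + q) C suc p)
      ≡⟨ cong₂ _+_ ballot-A (ballot (suc k) (suc p) q p<q) ⟩
    (suc p + q) C suc p + (suc p + q) C suc (suc p) ∎
    where
    A B : ℕ
    A = length (interleavings (suc k) (suc p) (suc q))
    B = length (interleavings (suc k) (suc (suc p)) q)
    ballot-A : A + (suc p + q) C p ≡ (suc p + q) C suc p
    ballot-A = subst (λ n → A + n C p ≡ n C suc p) (+-suc p q)
      (ballot (suc k) p (suc q) (≤-trans (<⇒≤ p<q) (n≤1+n q)))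

-- The central binomial coefficient (2m + 2) C (m + 1) and its left neighbour
-- are in the ratio (m + 2) : (m + 1).

middle-ratio : ∀ m → suc m * ((m + suc (suc m)) C suc m) ≡ suc (suc m) * ((m + suc (suc m)) C m)
middle-ratio m = +-cancelˡ-≡ (suc m * x) _ _ (begin
  suc m * x + suc m * y      ≡⟨ *-distribˡ-+ (suc m) x y ⟨
  suc m * (x + y)            ≡⟨ cong (suc m *_) (nCk+nC[k+1]≡[n+1]C[k+1] n m) ⟩
  suc m * (suc n C suc m)    ≡⟨ absorption n m ⟩
  suc n * x                  ≡⟨ *-distribʳ-+ x (suc m) (suc (suc m)) ⟩
  suc m * x + suc (suc m) * x ∎)
  where
  open ≡-Reasoning
  n x y : ℕ
  n = m + suc (suc m)
  x = n C m
  y = n C suc m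

count-catalan : ∀ k m → length (interleavings k (suc m) (suc (suc m))) ≡ catalan (suc m)
count-catalan k m = *-cancelˡ-≡ L (catalan (suc m)) (suc (suc m))
  (+-cancelʳ-≡ (suc m * y) _ _ (begin
    suc (suc m) * L + suc m * y            ≡⟨ cong (suc (suc m) * L +_) (middle-ratio m) ⟩
    suc (suc m) * L + suc (suc m) * x      ≡⟨ *-distribˡ-+ (suc (suc m)) L x ⟨
    suc (suc m) * (L + x)                  ≡⟨ cong (suc (suc m) *_)
                                                (ballot k m (suc (suc m)) (n≤1+n _)) ⟩
    y + suc m * y                          ≡⟨ cong (λ a → a C suc m + suc m * y) (even m) ⟩
    (2 * suc m) C suc m + suc m * y        ≡⟨ cong (_+ suc m * y) (suc[n]*catalan (suc m)) ⟨
    suc (suc m) * catalan (suc m) + suc m * y ∎))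
  where
  open ≡-Reasoning
  L x y : ℕ
  L = length (interleavings k (suc m) (suc (suc m)))
  x = (m + suc (suc m)) C m
  y = (m + suc (suc m)) C suc m
  even : ∀ m → m + suc (suc m) ≡ 2 * suc m
  even = solve-∀

theorem12 : ∀ (n : ℕ) → 2 ≤ n → full P₂⁽²'²⁾ n ≡ catalan (n ∸ 1)
theorem12 (suc (suc m)) _ = trans (full-interleavings (suc m)) (count-catalan 2 m)
theorem12 (suc zero) (s≤s ())
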